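{- The resumption semantics of stateful SOS specifications is compositional. That is, let $\mathcal L$ be a stateful SOS specification over a signature $\Sigma$ and a countable set $S$ of states, with resumption semantics $[-]_{\mathcal L}\colon\mu\Sigma\to\nu T$. Then for every $n$-ary operator $\mathsf f\in\Sigma$ and all programs $p_i,q_i\in\mu\Sigma$ ($i=1,\dots,n$), if $[p_i]_{\mathcal L}=[q_i]_{\mathcal L}$ for $i=1,\dots,n$, then $[\mathsf f(p_1,\dots,p_n)]_{\mathcal L}=[\mathsf f(q_1,\dots,q_n)]_{\mathcal L}$.
   Context: **Signature and terms.** An algebraic signature $\Sigma$ is a set of operation symbols $\mathsf f$ with arities $\mathrm{ar}(\mathsf f)\in\mathbb N$; it is identified with the polynomial functor $\Sigma X=\coprod_{\mathsf f\in\Sigma}X^{\mathrm{ar}(\mathsf f)}$ on $\mathbf{Set}$. $\Sigma^{\star}X$ is the set of $\Sigma$-terms with variables from $X$ (free $\Sigma$-algebra; $\Sigma^\star$ is the free monad). $\mu\Sigma=\Sigma^\star\emptyset$ is the set of closed terms (programs), the initial $\Sigma$-algebra with structure $\iota\colon\Sigma(\mu\Sigma)\to\mu\Sigma$. For a $\Sigma$-algebra $(A,\alpha)$, $\hat\alpha\colon\Sigma^\star A\to A$ is the term evaluation map. $1=\{*\}$. $\mathcal V=\{x_1,x_2,\dots\}\cup\{y_1,y_2,\dots\}$ is a countably infinite set of variables. **Specifications.** A progressing literal is $s,p\to s',q$ and a terminating literal is $s,p\downarrow s'$, with $s,s'\in S$, $p,q\in\Sigma^\star\mathcal V$ (input $s$,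 source $p$, output $s'$, target $q$). A stateful SOS rule for an $n$-ary $\mathsf f$ is an expression $l_1\dots l_n/L$ of literals (premisses $l_j$, conclusion $L$) with the same input $s$, such that the source of $l_j$ is $x_j$, its target is $y_j$ if it is progressing, the source of $L$ is $\mathsf f(x_1,\dots,x_n)$, and if $L$ is progressing all variables of its target appear as source or target of some premiss. The rule is progressing/terminating if $L$ is. Its trigger is $(s,(s_1',\mathtt c_1),\dots,(s_n',\mathtt c_n))$, where $s_j'$ is the output of $l_j$ and $\mathtt c_j=\mathtt{pr}$ or $\mathtt{te}$ according to whether $l_j$ is progressing or terminating. A stateful SOS specification is a set of rules containing, for each $n$-ary $\mathsf f$ and each $(s,(s_1',\mathtt c_1),\dots,(s_n',\mathtt c_n))$ with $s,s_j'\in S$, $\mathtt c_j\in\{\mathtt{pr},\mathtt{te}\}$, exactly one rule for $\mathsf f$ with that trigger. **Associated law.** $\mathcal L$ induces a natural transformation $\delta_X\colon S\times\Sigma(X\times(S\times(X+1)))\to S\times(\Sigma^\star X+1)$, the copairing of maps $\delta^{\mathsf f}_X\colon S\times(X\times(S\times(X+1)))^{\mathrm{ar}(\mathsf f)}\to S\times(\Sigma^\star X+1)$: given $(s,((v_1,s_1',w_1),\dots,(v_n,s_n',w_n)))$, take the unique rule for $\mathsf f$ with trigger $(s,(s'_1,\mathtt c_1),\dots,(s'_n,\mathtt c_n))$, where $\mathtt c_j=\mathtt{pr}$ if $w_j\in X$ and $\mathtt c_j=\mathtt{te}$ if $w_j=*$; with $s'$ the output of its conclusion, the value is $(s',*)$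 if the rule is terminating and otherwise $(s',t')$, where $t'$ is the target of the conclusion with $x_j$ replaced by $v_j$ and $y_j$ by $w_j$. **Resumption semantics.** Let $TX=(S\times(X+1))^S$, with final coalgebra $\tau\colon\nu T\to T(\nu T)$ (possibly infinite $S$-branching trees with more than one node and $S$-labelled edges). The GSOS law $\hat\delta_X\colon\Sigma(X\times TX)\to T\Sigma^\star X$ is given by $\hat\delta_X(\mathsf f((v_1,g_1),\dots,(v_n,g_n)))(s)=\delta^{\mathsf f}_X(s,((v_1,g_1(s)),\dots,(v_n,g_n(s))))$. Its operational model is the unique map $\gamma\colon\mu\Sigma\to T(\mu\Sigma)$ with $\gamma\cdot\iota=T\hat\iota\cdot\hat\delta_{\mu\Sigma}\cdot\Sigma\langle\mathrm{id},\gamma\rangle$. The resumption semantics $[-]_{\mathcal L}\colon\mu\Sigma\to\nu T$ is the unique $T$-coalgebra homomorphism from $(\mu\Sigma,\gamma)$ to $(\nu T,\tau)$. -}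

module Defs where

open import Data.Empty using (⊥)
open import Data.Fin using (Fin; zero; suc; toℕ)
open import Data.List using (List; []; _∷_)
open import Data.Maybe using (Maybe; just; nothing)
open import Data.Nat using (ℕ; zero; suc)
open import Data.Product using (Σ-syntax; ∃-syntax; ∃!; _×_; _,_; proj₁; proj₂; map₂)
open import Data.Product.Relation.Binary.Pointwise.NonDependent using (×-setoid)
open import Data.Sum using (_⊎_; inj₁; inj₂; map₁)
open import Data.Sum.Relation.Binary.Pointwise using (⊎-setoid; inj₁; inj₂)
open import Data.Unit using (⊤; tt)
open import Data.Vec using (Vec; []; _∷_; lookup; tabulate; map)
open import Data.Vec.Properties using (lookup-map)
open import Data.Vec.Relation.Unary.Any using (Any; here; there)
open import Function using (_∘_; id)
open import Function.Bundles using (Func)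
open import Level using (0ℓ)
open import Relation.Binary.Bundles using (Setoid)
open import Relation.Binary.PropositionalEquality
  using (_≡_; refl; sym; trans; cong; cong₂; setoid; module ≡-Reasoning)
open import Relation.Unary using (Pred; _∈_)

import Function.Indexed.Relation.Binary.Equality as Indexed
import Relation.Binary.Indexed.Heterogeneous.Construct.Trivial as Trivial

open Func using (to)

------------------------------------------------------------------------
-- Signatures and terms

record Signature : Set₁ where
  field
    Op : Set
    ar : Op → ℕ

open Signature public

module _ (Sig : Signature) where

  -- The polynomial functor of the signature.
  ⟦_⟧ : Set → Set
  ⟦_⟧ X = Σ[ f ∈ Op Sig ] Vec X (ar Sig f)

  Algebra : Set → Set
  Algebra A = ⟦_⟧ A → A

  data Term (X : Set) : Set where
    var : X → Term X
    op  : (f : Op Sig) → Vec (Term X) (ar Sig f) → Term X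

  μ : Set
  μ = Term ⊥

module _ {Sig : Signature} where

  ι : Algebra Sig (μ Sig)
  ι (f , ps) = op f ps

  module _ {A : Set} (α : Algebra Sig A) where

    evaluate  : Term Sig A → A
    evaluates : ∀ {n} → Vec (Term Sig A) n → Vec A n
    evaluate (var a)   = a
    evaluate (op f ts) = α (f , evaluates ts)
    evaluates []       = []
    evaluates (t ∷ ts) = evaluate t ∷ evaluates ts

  -- Primitive recursion on closed terms: the unique h with
  -- h ∘ ι = φ ∘ ⟦ Sig ⟧ ⟨ id , h ⟩; see recurse-ι.
  module _ {A : Set} (φ : ⟦ Sig ⟧ (μ Sig × A) → A) where

    recurse  : μ Sig → A
    recurses : ∀ {n} → Vec (μ Sig) n → Vec (μ Sig × A) n
    recurse (op f ps)  = φ (f , recurses ps)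
    recurses []        = []
    recurses (p ∷ ps)  = (p , recurse p) ∷ recurses ps

    recurses-map : ∀ {n} (ps : Vec (μ Sig) n) →
      recurses ps ≡ map (λ p → p , recurse p) ps
    recurses-map []       = refl
    recurses-map (p ∷ ps) = cong (_ ∷_) (recurses-map ps)

    recurse-ι : ∀ f (ps : Vec (μ Sig) (ar Sig f)) →
      recurse (ι (f , ps)) ≡ φ (f , map (λ p → p , recurse p) ps)
    recurse-ι f ps = cong (λ vs → φ (f , vs)) (recurses-map ps)

  data _occursIn_ {V : Set} (v : V) : Term Sig V → Set where
    here  : v occursIn (var v)
    there : ∀ {f ts} → Any (v occursIn_) ts → v occursIn (op f ts)

  -- Renaming by a map that need only be defined on the variables that occur.
  module _ {V X : Set} where

    rename  : (t : Term Sig V) → (∀ v → v occursIn t → X) → Term Sig X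
    renames : ∀ {n} (ts : Vec (Term Sig V) n) →
              (∀ v → Any (v occursIn_) ts → X) → Vec (Term Sig X) n
    rename (var v)   σ  = var (σ v here)
    rename (op f ts) σ  = op f (renames ts (λ v → σ v ∘ there))
    renames []       σ  = []
    renames (t ∷ ts) σ  = rename t (λ v → σ v ∘ here) ∷ renames ts (λ v → σ v ∘ there)

------------------------------------------------------------------------
-- Stateful SOS specifications

-- Numbering starts at zero: x k and y k stand for x_{k+1} and y_{k+1}.
data Var : Set where
  x y : ℕ → Var

data Kind : Set where
  pr te : Kind

module _ (Sig : Signature) (S : Set) where

  -- Arguments: input, source, output, and (if progressing) target.
  data Literal : Set where
    progressing : S → Term Sig Var → S → Term Sig Var → Literal
    terminating : S → Term Sig Var → S → Literal

  record Expression (n : ℕ) : Set where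
    constructor _/_
    field
      premisses  : Vec Literal n
      conclusion : Literal

  Trigger : ℕ → Set
  Trigger n = S × Vec (S × Kind) n

module _ {Sig : Signature} {S : Set} where

  input : Literal Sig S → S
  input (progressing s _ _ _) = s
  input (terminating s _ _)   = s

  source : Literal Sig S → Term Sig Var
  source (progressing _ p _ _) = p
  source (terminating _ p _)   = p

  output : Literal Sig S → S
  output (progressing _ _ s′ _) = s′
  output (terminating _ _ s′)   = s′

  target : Literal Sig S → Maybe (Term Sig Var)
  target (progressing _ _ _ q) = just q
  target (terminating _ _ _)   = nothing

  kind : Literal Sig S → Kind
  kind (progressing _ _ _ _) = pr
  kind (terminating _ _ _)   = te

  open Expression public

  record IsRule (f : Op Sig) (r : Expression Sig S (ar Sig f)) : Set where
    private
      l : Fin (ar Sig f) → Literal Sig S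
      l = lookup (premisses r)
    field
      same-input        : ∀ j → input (l j) ≡ input (conclusion r)
      premiss-source    : ∀ j → source (l j) ≡ var (x (toℕ j))
      premiss-target    : ∀ j t → target (l j) ≡ just t → t ≡ var (y (toℕ j))
      conclusion-source : source (conclusion r) ≡ op f (tabulate (λ j → var (x (toℕ j))))
      conclusion-target : ∀ t → target (conclusion r) ≡ just t → ∀ v → v occursIn t →
                          ∃[ j ] (source (l j) ≡ var v ⊎ target (l j) ≡ just (var v))

  trigger : ∀ {n} → Expression Sig S n → Trigger Sig S n
  trigger r = input (conclusion r) , map (λ l → output l , kind l) (premisses r)

record Specification (Sig : Signature) (S : Set) : Set₁ where
  field
    Rules      : (f : Op Sig) → Pred (Expression Sig S (ar Sig f)) 0ℓ
    isRule     : ∀ {f r} → r ∈ Rules f → IsRule f r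
    exactlyOne : ∀ f (θ : Trigger Sig S (ar Sig f)) →
                 ∃! _≡_ (λ r → r ∈ Rules f × trigger r ≡ θ)

------------------------------------------------------------------------
-- The associated law

module _ {X : Set} where

  kindOf : X ⊎ ⊤ → Kind
  kindOf (inj₁ _) = pr
  kindOf (inj₂ _) = te

  fromPr : (w : X ⊎ ⊤) → kindOf w ≡ pr → X
  fromPr (inj₁ w) _ = w

module _ {Sig : Signature} {S : Set} (L : Specification Sig S) {X : Set} where

  open Specification L
  open IsRule

  triggerOf : ∀ {n} → S → Vec (X × S × (X ⊎ ⊤)) n → Trigger Sig S n
  triggerOf s vs = s , map (λ (_ , s′ , w) → s′ , kindOf w) vs

  private
    kind-pr : ∀ {t} (l : Literal Sig S) → target l ≡ just t → kind l ≡ pr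
    kind-pr (progressing _ _ _ _) _ = refl

    kinds-agree : ∀ {n} s (vs : Vec (X × S × (X ⊎ ⊤)) n) (r : Expression Sig S n) →
      trigger r ≡ triggerOf s vs → ∀ j →
      kindOf (proj₂ (proj₂ (lookup vs j))) ≡ kind (lookup (premisses r) j)
    kinds-agree s vs r eq j = begin
      kindOf (proj₂ (proj₂ (lookup vs j)))       ≡⟨ cong proj₂ (lookup-map j _ vs) ⟨
      proj₂ (lookup (proj₂ (triggerOf s vs)) j)  ≡⟨ cong (λ θ → proj₂ (lookup (proj₂ θ) j)) eq ⟨
      proj₂ (lookup (proj₂ (trigger r)) j)       ≡⟨ cong proj₂ (lookup-map j _ (premisses r)) ⟩
      kind (lookup (premisses r) j)              ∎
      where open ≡-Reasoning

  -- A variable of the conclusion's target that is the source of the j-th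
  -- premiss is x_j, and goes to v_j.  One that is the target of the j-th
  -- premiss is y_j, and goes to w_j, which lies in X since the premiss is
  -- then progressing.
  assign : ∀ {n} s (vs : Vec (X × S × (X ⊎ ⊤)) n) (r : Expression Sig S n) →
    trigger r ≡ triggerOf s vs → ∀ v →
    ∃[ j ] (source (lookup (premisses r) j) ≡ var v ⊎
            target (lookup (premisses r) j) ≡ just (var v)) → X
  assign s vs r eq v (j , inj₁ _) = proj₁ (lookup vs j)
  assign s vs r eq v (j , inj₂ e) =
    fromPr (proj₂ (proj₂ (lookup vs j)))
           (trans (kinds-agree s vs r eq j) (kind-pr (lookup (premisses r) j) e))

  conclude : (l : Literal Sig S) →
    (∀ t → target l ≡ just t → ∀ v → v occursIn t → X) → S × (Term Sig X ⊎ ⊤)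
  conclude (progressing _ _ s′ t) σ = s′ , inj₁ (rename t (σ t refl))
  conclude (terminating _ _ s′)   σ = s′ , inj₂ tt

  δ : ∀ f → S → Vec (X × S × (X ⊎ ⊤)) (ar Sig f) → S × (Term Sig X ⊎ ⊤)
  δ f s vs with exactlyOne f (triggerOf s vs)
  ... | r , (r∈ , eq) , _ =
    conclude (conclusion r)
      (λ t t≡ v v∈t → assign s vs r eq v (conclusion-target (isRule r∈) t t≡ v v∈t))

  δ̂ : ⟦ Sig ⟧ (X × (S → S × (X ⊎ ⊤))) → S → S × (Term Sig X ⊎ ⊤)
  δ̂ (f , vs) s = δ f s (map (map₂ (λ g → g s)) vs)

------------------------------------------------------------------------
-- T-coalgebras

-- Setoids play the role of sets: equality in the final T-coalgebra, and
-- equality of maps into T X, are extensional.  S itself carries _≡_.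

T₀ : Set → Set → Set
T₀ S X = S → S × (X ⊎ ⊤)

T₁ : ∀ {S X Y} → (X → Y) → T₀ S X → T₀ S Y
T₁ h g s = map₂ (map₁ h) (g s)

-- Carrier T₀ S X, with equality taken pointwise in S.
T : Set → Setoid 0ℓ 0ℓ → Setoid 0ℓ 0ℓ
T S X = Indexed.≡-setoid S
  (Trivial.indexedSetoid (×-setoid (setoid S) (⊎-setoid X (setoid ⊤))))

record Coalgebra (S : Set) : Set₁ where
  field
    states    : Setoid 0ℓ 0ℓ
    structure : Func states (T S states)

  open Setoid states public using (Carrier; _≈_)

open Coalgebra using (states; structure)

record Hom {S : Set} (C D : Coalgebra S) : Set where
  field
    func     : Func (states C) (states D)
    commutes : ∀ c → Setoid._≈_ (T S (states D))
                 (to (structure D) (to func c)) (T₁ (to func) (to (structure C) c))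

open Hom using (func; commutes)

record IsFinal {S : Set} (Z : Coalgebra S) : Set₁ where
  field
    !        : (C : Coalgebra S) → Hom C Z
    !-unique : ∀ {C} (h : Hom C Z) → ∀ c → Coalgebra._≈_ Z (to (func (! C)) c) (to (func h) c)

------------------------------------------------------------------------
-- Operational model and resumption semantics

module _ {Sig : Signature} {S : Set} (L : Specification Sig S) where

  γ : μ Sig → T₀ S (μ Sig)
  γ = recurse (T₁ (evaluate ι) ∘ δ̂ L)

  γ-ι : ∀ f (ps : Vec (μ Sig) (ar Sig f)) →
    γ (ι (f , ps)) ≡ T₁ (evaluate ι) (δ̂ L (f , map (λ p → p , γ p) ps))
  γ-ι = recurse-ι (T₁ (evaluate ι) ∘ δ̂ L)

  -- δ̂ only inspects the behaviours g_j at the given state, so the equation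
  -- γ-ι determines γ up to pointwise equality.
  γ-unique : (h : μ Sig → T₀ S (μ Sig)) →
    (∀ f ps s → h (ι (f , ps)) s ≡ T₁ (evaluate ι) (δ̂ L (f , map (λ p → p , h p) ps)) s) →
    ∀ p s → h p s ≡ γ p s
  γ-unique h h-ι = go
    where
    φ : ⟦ Sig ⟧ (μ Sig × T₀ S (μ Sig)) → T₀ S (μ Sig)
    φ = T₁ (evaluate ι) ∘ δ̂ L

    at : S → μ Sig × T₀ S (μ Sig) → μ Sig × S × (μ Sig ⊎ ⊤)
    at s = map₂ (λ g → g s)

    go  : ∀ p s → h p s ≡ γ p s
    gos : ∀ {n} (ps : Vec (μ Sig) n) s →
          map (at s) (map (λ p → p , h p) ps) ≡ map (at s) (recurses φ ps)
    go (op f ps) s = trans (h-ι f ps s)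
      (cong (λ vs → map₂ (map₁ (evaluate ι)) (δ L f s vs)) (gos ps s))
    gos []       s = refl
    gos (p ∷ ps) s = cong₂ _∷_ (cong (p ,_) (go p s)) (gos ps s)

  programs : Coalgebra S
  programs = record
    { states    = setoid (μ Sig)
    ; structure = record
      { to   = γ
      ; cong = λ { refl s → Setoid.refl (×-setoid (setoid S) (⊎-setoid (setoid (μ Sig)) (setoid ⊤))) }
      }
    }

  resumption : (Z : Coalgebra S) → IsFinal Z → μ Sig → Coalgebra.Carrier Z
  resumption Z final = to (func (IsFinal.! final programs))

------------------------------------------------------------------------
-- A final T-coalgebra exists

-- A tree is given by the label of each edge and whether that edge leads to an
-- inner node or to a leaf; the node an edge leaves is addressed by the word of
-- branches leading to it.  Data at words leading beyond a leaf is ignored by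
-- the equality.
module Trees (S : Set) where

  Tree : Set
  Tree = List S → S → S × Kind

  out : Tree → T₀ S Tree
  out t s = branch (t [] s) (λ w → t (s ∷ w))
    where
    branch : S × Kind → Tree → S × (Tree ⊎ ⊤)
    branch (s′ , pr) u = s′ , inj₁ u
    branch (s′ , te) u = s′ , inj₂ tt

  data Step (R : Tree → Tree → Set) : S × (Tree ⊎ ⊤) → S × (Tree ⊎ ⊤) → Set where
    next : ∀ {s t u} → R t u → Step R (s , inj₁ t) (s , inj₁ u)
    stop : ∀ {s} → Step R (s , inj₂ tt) (s , inj₂ tt)

  -- Agreement up to depth n.
  Agree : ℕ → Tree → Tree → Set
  Agree zero    t u = ⊤
  Agree (suc n) t u = ∀ s → Step (Agree n) (out t s) (out u s)

  _~_ : Tree → Tree → Set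
  t ~ u = ∀ n → Agree n t u

  private
    step-refl : ∀ {R} → (∀ t → R t t) → ∀ a → Step R a a
    step-refl r (s , inj₁ t)  = next (r t)
    step-refl r (s , inj₂ tt) = stop

    agree-refl : ∀ n t → Agree n t t
    agree-refl zero    t = tt
    agree-refl (suc n) t = λ s → step-refl (agree-refl n) (out t s)

    step-sym : ∀ {R} → (∀ {t u} → R t u → R u t) → ∀ {a b} → Step R a b → Step R b a
    step-sym f (next r) = next (f r)
    step-sym f stop     = stop

    agree-sym : ∀ n {t u} → Agree n t u → Agree n u t
    agree-sym zero    _ = tt
    agree-sym (suc n) p = λ s → step-sym (agree-sym n) (p s)

    step-trans : ∀ {R} → (∀ {t u v} → R t u → R u v → R t v) →
                 ∀ {a b c} → Step R a b → Step R b c → Step R a c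
    step-trans f (next p) (next q) = next (f p q)
    step-trans f stop     stop     = stop

    agree-trans : ∀ n {t u v} → Agree n t u → Agree n u v → Agree n t v
    agree-trans zero    _ _ = tt
    agree-trans (suc n) p q = λ s → step-trans (agree-trans n) (p s) (q s)

  treeSetoid : Setoid 0ℓ 0ℓ
  treeSetoid = record
    { Carrier       = Tree
    ; _≈_           = _~_
    ; isEquivalence = record
      { refl  = λ {t} n → agree-refl n t
      ; sym   = λ p n → agree-sym n (p n)
      ; trans = λ p q n → agree-trans n (p n) (q n)
      }
    }

  private
    module B (X : Setoid 0ℓ 0ℓ) = Setoid (×-setoid (setoid S) (⊎-setoid X (setoid ⊤)))

    collect : ∀ a b → (∀ n → Step (Agree n) a b) → B._≈_ treeSetoid a b
    collect (s , inj₁ t) (s′ , inj₁ u) p = fst (p 0) , inj₁ (λ n → snd (p n))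
      where
      fst : ∀ {R s s′ t u} → Step R (s , inj₁ t) (s′ , inj₁ u) → s ≡ s′
      fst (next _) = refl
      snd : ∀ {R s s′ t u} → Step R (s , inj₁ t) (s′ , inj₁ u) → R t u
      snd (next r) = r
    collect (s , inj₁ t)  (s′ , inj₂ tt) p with p 0
    ... | ()
    collect (s , inj₂ tt) (s′ , inj₁ u) p with p 0
    ... | ()
    collect (s , inj₂ tt) (s′ , inj₂ tt) p = eq (p 0) , inj₂ refl
      where
      eq : ∀ {R s s′} → Step R (s , inj₂ tt) (s′ , inj₂ tt) → s ≡ s′
      eq stop = refl

  trees : Coalgebra S
  trees = record
    { states    = treeSetoid
    ; structure = record
      { to   = out
      ; cong = λ {t} {u} p s → collect (out t s) (out u s) (λ n → p (suc n) s)
      }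
    }

  module _ (C : Coalgebra S) where

    private
      Carrier : Set
      Carrier = Coalgebra.Carrier C

      label : S × (Carrier ⊎ ⊤) → S × Kind
      label (s , w) = s , kindOf w

    unfold : Carrier → Tree
    below  : S × (Carrier ⊎ ⊤) → Tree
    unfold c []      s = label (to (structure C) c s)
    unfold c (s′ ∷ w)  = below (to (structure C) c s′) w
    below (_  , inj₁ c)  = unfold c
    below (s′ , inj₂ tt) = λ _ _ → s′ , te

    private
      out-unfold : ∀ c s → out (unfold c) s ≡ T₁ unfold (to (structure C) c) s
      out-unfold c s with to (structure C) c s
      ... | s′ , inj₁ c′ = refl
      ... | s′ , inj₂ tt = refl

      -- Any two homomorphisms up to ~ agree on equal states.
      agree : (h k : Carrier → Tree) →
        (∀ c s → B._≈_ treeSetoid (out (h c) s) (T₁ h (to (structure C) c) s)) →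
        (∀ c s → B._≈_ treeSetoid (out (k c) s) (T₁ k (to (structure C) c) s)) →
        ∀ n {c d} → Coalgebra._≈_ C c d → Agree n (h c) (k d)
      agree h k hh hk zero    _       = tt
      agree h k hh hk (suc n) {c} {d} c≈d s =
        combine (out (h c) s) (to (structure C) c s) (to (structure C) d s) (out (k d) s)
          (hh c s) (Func.cong (structure C) c≈d s) (hk d s)
        where
        combine : ∀ a c₁ d₁ b →
          B._≈_ treeSetoid a (map₂ (map₁ h) c₁) → B._≈_ (states C) c₁ d₁ →
          B._≈_ treeSetoid b (map₂ (map₁ k) d₁) → Step (Agree n) a b
        combine (_ , inj₁ t) (_ , inj₁ c′) (_ , inj₁ d′) (_ , inj₁ u)
          (refl , inj₁ p) (refl , inj₁ q) (refl , inj₁ r) =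
          next (agree-trans n (p n)
                 (agree-trans n (agree h k hh hk n q) (agree-sym n (r n))))
        combine (_ , inj₂ tt) (_ , inj₂ tt) (_ , inj₂ tt) (_ , inj₂ tt)
          (refl , inj₂ _) (refl , inj₂ _) (refl , inj₂ _) = stop

      unfold-commutes : ∀ c s →
        B._≈_ treeSetoid (out (unfold c) s) (T₁ unfold (to (structure C) c) s)
      unfold-commutes c s = B.reflexive treeSetoid (out-unfold c s)

    unfoldHom : Hom C trees
    unfoldHom = record
      { func     = record
        { to   = unfold
        ; cong = λ c≈d n → agree unfold unfold unfold-commutes unfold-commutes n c≈d
        }
      ; commutes = unfold-commutes
      }

    unfold-unique : (h : Hom C trees) → ∀ c → unfold c ~ to (func h) c
    unfold-unique h c n =
      agree unfold (to (func h)) unfold-commutes (commutes h) n (Setoid.refl (states C))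

  trees-final : IsFinal trees
  trees-final = record { ! = unfoldHom ; !-unique = λ {C} → unfold-unique C }

-- The congruence generated by the kernel of the resumption semantics is a
-- bisimulation: the rule that applies to f(p₁,…,pₙ) depends only on the outputs
-- and kinds of the behaviours of the pⱼ, so congruent arguments fire the same
-- rule, and substituting congruent terms into its target yields congruent terms.
-- Hence γ is also a coalgebra structure on the programs modulo this congruence.
-- By uniqueness the resumption semantics factors through that quotient, so
-- congruent programs have the same semantics.
module Submission where

open import Defs
open import Data.Fin using (Fin)
open import Data.Nat using (ℕ)
open import Data.Product using (_×_; _,_; proj₁; proj₂; map₂)
import Data.Product.Relation.Binary.Pointwise.NonDependent as Product
open import Data.Product.Relation.Binary.Pointwise.NonDependent using (×-setoid)
open import Data.Sum using (_⊎_; inj₁; inj₂; map₁)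
import Data.Sum.Relation.Binary.Pointwise as Sum
open import Data.Unit using (⊤)
open import Data.Vec using (Vec; lookup; map)
open import Data.Vec.Relation.Binary.Pointwise.Inductive as Pointwise using (Pointwise; []; _∷_)
open import Data.Vec.Relation.Binary.Pointwise.Extensional using (ext; extensional⇒inductive)
open import Data.Vec.Relation.Unary.Any using (Any; here; there)
open import Function using (_∘_)
open import Function.Bundles using (_↣_; Func)
open import Level using (0ℓ)
open import Relation.Binary.Bundles using (Setoid)
open import Relation.Binary.Core using (Rel; _⇒_)
open import Relation.Binary.PropositionalEquality
  using (_≡_; refl; trans; cong; cong₂; subst₂; setoid)
open import Relation.Binary.PropositionalEquality.Properties using (trans-reflʳ)

Compatible : {Sig : Signature} {A : Set} → Algebra Sig A → Rel A 0ℓ → Set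
Compatible {Sig} α R =
  ∀ f {as bs : Vec _ (ar Sig f)} → Pointwise R as bs → R (α (f , as)) (α (f , bs))

-- This is the relation lifting of the functor sending `X` to `S × (X ⊎ ⊤)`: `R` is a bisimulation
-- when related programs have `Outcome R`-related steps at every input state.
Outcome : {S X : Set} → Rel X 0ℓ → Rel (S × (X ⊎ ⊤)) 0ℓ
Outcome R = Product.Pointwise _≡_ (Sum.Pointwise R _≡_)

outcome-map : ∀ {S X : Set} {Q R : Rel X 0ℓ} → Q ⇒ R → Outcome {S} Q ⇒ Outcome R
outcome-map Q⇒R (s≡ , Sum.inj₁ q) = s≡ , Sum.inj₁ (Q⇒R q)
outcome-map Q⇒R (s≡ , Sum.inj₂ e) = s≡ , Sum.inj₂ e

outcome-preimage : ∀ {S X Y : Set} {R : Rel Y 0ℓ} (h : X → Y) (a b : S × (X ⊎ ⊤)) →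
  Outcome R (map₂ (map₁ h) a) (map₂ (map₁ h) b) → Outcome (λ u v → R (h u) (h v)) a b
outcome-preimage h (_ , inj₁ _) (_ , inj₁ _) (s≡ , Sum.inj₁ r) = s≡ , Sum.inj₁ r
outcome-preimage h (_ , inj₂ _) (_ , inj₂ _) (s≡ , Sum.inj₂ e) = s≡ , Sum.inj₂ e

module _ {Sig : Signature} {A : Set} (α : Algebra Sig A)
         {R : Rel A 0ℓ} (compatible : Compatible α R) where

  -- Induction on the term, with `compatible` at each operation. The renamings are compared at the
  -- same occurrence proof, since their values may depend on it.
  evaluate-rename : ∀ {V} (t : Term Sig V) {σ σ′ : ∀ v → v occursIn t → A} →
    (∀ v v∈t → R (σ v v∈t) (σ′ v v∈t)) →
    R (evaluate α (rename t σ)) (evaluate α (rename t σ′))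
  evaluates-renames : ∀ {V n} (ts : Vec (Term Sig V) n)
    {σ σ′ : ∀ v → Any (v occursIn_) ts → A} →
    (∀ v v∈ts → R (σ v v∈ts) (σ′ v v∈ts)) →
    Pointwise R (evaluates α (renames ts σ)) (evaluates α (renames ts σ′))
  evaluate-rename (var v)   rel = rel v here
  evaluate-rename (op f ts) rel =
    compatible f (evaluates-renames ts (λ v → rel v ∘ there))
  evaluates-renames Vec.[]       rel = []
  evaluates-renames (t Vec.∷ ts) rel =
    evaluate-rename t (λ v → rel v ∘ here) ∷ evaluates-renames ts (λ v → rel v ∘ there)

module _ {Sig : Signature} {S : Set} (L : Specification Sig S) {X : Set} where

  open Specification L
  open IsRule

  -- The body of `δ` with the rule and its membership proof made parameters, so that one choice of
  -- both can serve two argument tuples.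
  applyRule : ∀ {f} s (vs : Vec (X × S × (X ⊎ ⊤)) (ar Sig f)) {r} → Rules f r →
    trigger r ≡ triggerOf L s vs → S × (Term Sig X ⊎ ⊤)
  applyRule s vs {r} r∈ eq = conclude L (conclusion r)
    (λ t t≡ v v∈t → assign L s vs r eq v (conclusion-target (isRule r∈) t t≡ v v∈t))

  -- Membership in Rules f need not be a proposition, so two argument tuples with
  -- the same trigger are compared through one common value of exactlyOne.
  δ-applyRule : ∀ f s (vs : Vec (X × S × (X ⊎ ⊤)) (ar Sig f)) {θ}
    (e : θ ≡ triggerOf L s vs) → let (_ , (r∈ , eq) , _) = exactlyOne f θ in
    applyRule s vs r∈ (trans eq e) ≡ δ L f s vs
  δ-applyRule f s vs refl with exactlyOne f (triggerOf L s vs)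
  ... | _ , (r∈ , eq) , _ = cong (applyRule s vs r∈) (trans-reflʳ eq)

module _ {Sig : Signature} {S : Set} (L : Specification Sig S) {A : Set}
         (α : Algebra Sig A) {R : Rel A 0ℓ} (compatible : Compatible α R) where

  open Specification L
  open IsRule

  -- `R` is required of the arguments too, not only of their successors, because a conclusion's
  -- target may mention `x j` as well as `y j`.
  Behaviour : Rel (A × S × (A ⊎ ⊤)) 0ℓ
  Behaviour = Product.Pointwise R (Outcome R)

  triggerOf-cong : ∀ {n} s {vs ws : Vec (A × S × (A ⊎ ⊤)) n} →
    Pointwise Behaviour vs ws → triggerOf L s vs ≡ triggerOf L s ws
  triggerOf-cong s vs~ws = cong (s ,_) (entries vs~ws)
    where
    kindOf-cong : ∀ {v w : A ⊎ ⊤} → Sum.Pointwise R _≡_ v w → kindOf v ≡ kindOf w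
    kindOf-cong (Sum.inj₁ _) = refl
    kindOf-cong (Sum.inj₂ _) = refl

    entries : ∀ {n} {vs ws : Vec (A × S × (A ⊎ ⊤)) n} → Pointwise Behaviour vs ws →
      map (λ (_ , s′ , w) → s′ , kindOf w) vs ≡ map (λ (_ , s′ , w) → s′ , kindOf w) ws
    entries []                     = refl
    entries ((_ , s≡ , w) ∷ vs~ws) =
      cong₂ Vec._∷_ (cong₂ _,_ s≡ (kindOf-cong w)) (entries vs~ws)

  -- The kind proofs are arbitrary because `assign` derives them from two different trigger
  -- equations.
  fromPr-cong : ∀ {v w : A ⊎ ⊤} → Sum.Pointwise R _≡_ v w →
    (pv : kindOf v ≡ pr) (pw : kindOf w ≡ pr) → R (fromPr v pv) (fromPr w pw)
  fromPr-cong (Sum.inj₁ r) _ _ = r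

  -- The shared `o` makes both sides read the same position `j`, and there both the argument or both
  -- its successor.
  assign-cong : ∀ {n} s {vs ws : Vec (A × S × (A ⊎ ⊤)) n} → Pointwise Behaviour vs ws →
    ∀ r (eq : trigger r ≡ triggerOf L s vs) (eq′ : trigger r ≡ triggerOf L s ws) v o →
    R (assign L s vs r eq v o) (assign L s ws r eq′ v o)
  assign-cong s vs~ws r eq eq′ v (j , inj₁ _) = proj₁ (Pointwise.lookup vs~ws j)
  assign-cong s vs~ws r eq eq′ v (j , inj₂ _) =
    fromPr-cong (proj₂ (proj₂ (Pointwise.lookup vs~ws j))) _ _

  conclude-cong : ∀ l {σ σ′} → (∀ t t≡ v v∈t → R (σ t t≡ v v∈t) (σ′ t t≡ v v∈t)) →
    Outcome R (map₂ (map₁ (evaluate α)) (conclude L l σ))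
              (map₂ (map₁ (evaluate α)) (conclude L l σ′))
  conclude-cong (progressing _ _ _ t) rel =
    refl , Sum.inj₁ (evaluate-rename α compatible t (rel t refl))
  conclude-cong (terminating _ _ _)   rel = refl , Sum.inj₂ refl

  applyRule-cong : ∀ {f} s {vs ws} → Pointwise Behaviour vs ws →
    ∀ {r} (r∈ : Rules f r) eq eq′ →
    Outcome R (map₂ (map₁ (evaluate α)) (applyRule L s vs r∈ eq))
              (map₂ (map₁ (evaluate α)) (applyRule L s ws r∈ eq′))
  applyRule-cong s vs~ws {r} r∈ eq eq′ = conclude-cong (conclusion r)
    (λ t t≡ v v∈t → assign-cong s vs~ws r eq eq′ v
      (conclusion-target (isRule r∈) t t≡ v v∈t))

  δ-cong : ∀ f s {vs ws} → Pointwise Behaviour vs ws →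
    Outcome R (map₂ (map₁ (evaluate α)) (δ L f s vs))
              (map₂ (map₁ (evaluate α)) (δ L f s ws))
  δ-cong f s {vs} {ws} vs~ws = subst₂
    (λ a b → Outcome R (map₂ (map₁ (evaluate α)) a) (map₂ (map₁ (evaluate α)) b))
    (δ-applyRule L f s vs refl)
    -- The rule is chosen for the trigger of `vs`; equality of the triggers transports that choice
    -- to `ws`.
    (δ-applyRule L f s ws (triggerOf-cong s vs~ws))
    (applyRule-cong s vs~ws (proj₁ (proj₁ (proj₂ (exactlyOne f (triggerOf L s vs))))) _ _)

module _ {Sig : Signature} {S : Set} (L : Specification Sig S)
         (νT : Coalgebra S) (final : IsFinal νT) where

  open Coalgebra using (states; structure)
  open Hom using (func; commutes)
  open IsFinal final
  open Func using (to)

  private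
    module ν = Setoid (states νT)
    module Tν = Setoid (T S (states νT))

    [_] : μ Sig → ν.Carrier
    [_] = resumption L νT final

  -- Symmetry and transitivity are imposed so that this relation can be the equality of a setoid;
  -- reflexivity comes from `kernel`.
  data _≅_ : Rel (μ Sig) 0ℓ where
    kernel     : ∀ {p q} → [ p ] ν.≈ [ q ] → p ≅ q
    congruence : Compatible ι _≅_
    symmetric  : ∀ {p q} → p ≅ q → q ≅ p
    transitive : ∀ {p q r} → p ≅ q → q ≅ r → p ≅ r

  ≅-setoid : Setoid 0ℓ 0ℓ
  ≅-setoid = record
    { _≈_           = _≅_
    ; isEquivalence = record
      { refl = kernel ν.refl ; sym = symmetric ; trans = transitive }
    }

  private
    module Q = Setoid (×-setoid (setoid S) (Sum.⊎-setoid ≅-setoid (setoid ⊤)))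

  -- Since `[_]` is a homomorphism, both steps have equal images under `T₁ [_]`, which preserves
  -- output states and kinds, so the equality reflects back to the steps.
  γ-kernel : ∀ {p q} → [ p ] ν.≈ [ q ] → ∀ s →
    Outcome (λ u v → [ u ] ν.≈ [ v ]) (γ L p s) (γ L q s)
  γ-kernel {p} {q} [p]≈[q] s = outcome-preimage [_] (γ L p s) (γ L q s)
    (Tν.trans {T₁ [_] (γ L p)} {to (structure νT) [ p ]} {T₁ [_] (γ L q)}
      (Tν.sym {to (structure νT) [ p ]} {T₁ [_] (γ L p)} (commutes (! (programs L)) p))
      (Tν.trans {to (structure νT) [ p ]} {to (structure νT) [ q ]} {T₁ [_] (γ L q)}
        (Func.cong (structure νT) [p]≈[q])
        (commutes (! (programs L)) q))
      s)

  -- Induction on the derivation of `p ≅ q`, not on the programs; only the `congruence` case looks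
  -- into the specification.
  γ-cong  : ∀ {p q} → p ≅ q → ∀ s → γ L p s Q.≈ γ L q s
  -- Stated with `recurses φ`, to which `γ` unfolds on `op f ps`, so that `δ-cong` applies without
  -- rewriting.
  γ-congs : ∀ {n} {ps qs : Vec (μ Sig) n} → Pointwise _≅_ ps qs → ∀ s →
    let φ = T₁ (evaluate ι) ∘ δ̂ L in
    Pointwise (Behaviour L ι congruence)
      (map (map₂ (λ g → g s)) (recurses φ ps)) (map (map₂ (λ g → g s)) (recurses φ qs))
  γ-cong (kernel e)           s = outcome-map kernel (γ-kernel e s)
  γ-cong (congruence f ps≅qs) s = δ-cong L ι congruence f s (γ-congs ps≅qs s)
  γ-cong (symmetric p≅q)      s = Q.sym (γ-cong p≅q s)
  γ-cong (transitive p≅q q≅r) s = Q.trans (γ-cong p≅q s) (γ-cong q≅r s)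
  γ-congs []            s = []
  γ-congs (p≅q ∷ ps≅qs) s = (p≅q , γ-cong p≅q s) ∷ γ-congs ps≅qs s

  quotient : Coalgebra S
  quotient = record
    { states    = ≅-setoid
    ; structure = record { to = γ L ; cong = γ-cong }
    }

  -- The identity on programs is a homomorphism into `quotient`, both structures being `γ`; this is
  -- its composite with the final map.
  fromQuotient : Hom (programs L) νT
  fromQuotient = record
    { func     = record { to = to (func (! quotient)) ; cong = λ { refl → ν.refl } }
    ; commutes = commutes (! quotient)
    }

  -- By finality `[_]` agrees with `fromQuotient`, whose underlying map respects `_≅_` because it is
  -- a map out of `quotient`.
  ≅⇒≈ : ∀ {p q} → p ≅ q → [ p ] ν.≈ [ q ]
  ≅⇒≈ {p} {q} p≅q =
    ν.trans (!-unique fromQuotient p)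
      (ν.trans (Func.cong (func (! quotient)) p≅q) (ν.sym (!-unique fromQuotient q)))

theorem4p6 : (Sig : Signature) (S : Set) → S ↣ ℕ →
    (L : Specification Sig S) (νT : Coalgebra S) (final : IsFinal νT) →
    let open Coalgebra νT using (_≈_)
        [_] = resumption L νT final
    in (f : Op Sig) (p q : Vec (μ Sig) (ar Sig f)) →
       (∀ (i : Fin (ar Sig f)) → [ lookup p i ] ≈ [ lookup q i ]) →
       [ op f p ] ≈ [ op f q ]
theorem4p6 Sig S _ L νT final f p q [p]≈[q] =
  ≅⇒≈ L νT final
    (congruence f (extensional⇒inductive (ext (λ i → kernel ([p]≈[q] i)))))
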